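{- Let $H=(V,E)$ be a hypergraph and let $e\in E$. Then $$T_{\mathrm{HG}}(H;x,y)=(x-1)^{\Delta(e)}\,T_{\mathrm{HG}}(H\setminus e;x,y)+(y-1)^{m(e)}\,T_{\mathrm{HG}}(H/e;x,y),$$ where $\Delta(e)=\kappa(H\setminus e)-\kappa(H)$ and $m(e)=d(e)-v(e)$.
   Context: A hypergraph is a pair $H=(V,E)$ where $V$ is a finite set and $E$ is a finite multiset (parallel hyperedges are allowed and treated as distinct elements of $E$) of multisets of elements of $V$, called hyperedges. For $e\in E$, $d(e)$ is the size of $e$ counted with multiplicity and $v(e)$ is the number of distinct vertices in $e$; it is always assumed that $d(e)>1$. Write $v(H)=|V|$. $\kappa(H)$ is the number of connected components of the bipartite incidence graph with vertex classes $V$ and $E$, in which $u\in V$ and $e\in E$ are joined by as many edges as the multiplicity of $u$ in $e$. For $A\subseteq E$ let $H|_A=(V,A)$, $\kappa(A)=\kappa(H|_A)$, $d(A)=\sum_{e\in A}d(e)$, and $|A|$ is the number of hyperedges in $A$. Hypergraph Tutte polynomial: $T_{\mathrm{HG}}(H;x,y)=\sum_{A\subseteq E}(x-1)^{\kappa(A)-\kappa(H)}(y-1)^{d(A)-|A|-v(H)+\kappa(A)}$. Deletion: $H\setminus e=(V,E\setminus\{e\})$. Contraction: $H/e=(V',E')$ with $V'=(V\setminus e)\cup\{v_e\}$ (all vertices occurring in $e$ are removed and one new vertex $v_e$ is added) and $E'=\{f' : f\in E\setminus\{e\}\}$, where $f'$ is the multiset obtained from $f$ by replacing every occurrence (with multiplicity)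 of a vertex of $e$ by $v_e$; thus $d(f')=d(f)$. -}

module Defs where

open import Algebra.Bundles using (CommutativeRing)
import Algebra.Properties.Semiring.Exp as Exp
open import Data.Fin.Base using (Fin; zero; suc)
open import Data.Fin.Properties using (_≟_)
open import Data.List.Base
  using (List; []; _∷_; _++_; map; foldr; length; filter; deduplicate;
         lookup; removeAt; allFin; cartesianProduct)
open import Data.Nat.ListAction using (sum)
open import Data.List.Membership.Propositional using (_∈_; _∉_)
open import Data.List.Membership.Propositional.Properties
  using (∈-filter⁺; ∈-filter⁻; ∈-cartesianProduct⁺; ∈-allFin;
         ∈-map⁺; ∈-++⁺ˡ; ∈-++⁺ʳ)
import Data.List.Membership.DecPropositional as DecMembership
open import Data.List.Properties using (length-map)
open import Data.List.Relation.Unary.Any using (here; there; index)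
open import Data.Nat.Base using (ℕ; suc; _+_; _∸_; _<_)
open import Data.Product.Base using (_×_; _,_; proj₁; proj₂)
open import Data.Sum.Base using (_⊎_; inj₁; inj₂)
import Data.Sum.Properties as Sum
open import Relation.Binary.Construct.Closure.Equivalence using (EqClosure)
import Relation.Binary.Construct.Closure.Equivalence as EqC
open import Relation.Binary.Construct.Closure.ReflexiveTransitive
  using (Star; ε; _◅_; _◅◅_)
open import Relation.Binary.Construct.Closure.Symmetric using (SymClosure; fwd; bwd)
open import Relation.Binary.Core using (Rel)
open import Relation.Binary.Definitions using (Decidable; DecidableEquality)
open import Relation.Binary.PropositionalEquality.Core using (_≡_; refl; sym; subst)
open import Relation.Nullary.Decidable
  using (yes; no; map′; ¬?; _×-dec_; _⊎-dec_)

module _ {n : ℕ} where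
  open DecMembership (_≟_ {n}) public using (_∈?_)

------------------------------------------------------------------------
-- Hypergraphs

-- A multiset is a list whose order is ignored by everything below.  In
-- particular `u ∈ verts e` has exactly as many inhabitants as u has
-- occurrences in e.

record Hyperedge (n : ℕ) : Set where
  constructor hyperedge
  field
    verts : List (Fin n)
    1<d   : 1 < length verts

open Hyperedge public

d : ∀ {n} → Hyperedge n → ℕ
d e = length (verts e)

v : ∀ {n} → Hyperedge n → ℕ
v {n} e = length (filter (_∈? verts e) (allFin n))

-- V = Fin ∣V∣.  Elements of E are positions in the list `edges`, so that
-- parallel hyperedges are distinct.

record Hypergraph : Set where
  constructor hypergraph
  field
    ∣V∣   : ℕ
    edges : List (Hyperedge ∣V∣)

open Hypergraph public

E : Hypergraph → Set
E H = Fin (length (edges H))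

infixl 5 _∣ₑ_ _∖_ _/_

_∣ₑ_ : (H : Hypergraph) → List (Hyperedge (∣V∣ H)) → Hypergraph
H ∣ₑ A = hypergraph (∣V∣ H) A

-- One list for each subset of the positions of a list.
subsets : ∀ {a} {A : Set a} → List A → List (List A)
subsets []       = [] ∷ []
subsets (x ∷ xs) = map (x ∷_) (subsets xs) ++ subsets xs

dₑ : ∀ {n} → List (Hyperedge n) → ℕ
dₑ A = sum (map d A)

------------------------------------------------------------------------
-- Deletion and contraction

_∖_ : (H : Hypergraph) → E H → Hypergraph
H ∖ e = hypergraph (∣V∣ H) (removeAt (edges H) e)

-- The vertex set of H / e is Fin (suc (length (outside e))): `zero` is
-- the new vertex v_e and `suc i` is the i-th vertex of V not in e.

outside : ∀ {n} → Hyperedge n → List (Fin n)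
outside {n} e = filter (λ u → ¬? (u ∈? verts e)) (allFin n)

∈-outside : ∀ {n} (e : Hyperedge n) {u : Fin n} → u ∉ verts e → u ∈ outside e
∈-outside e {u} u∉e = ∈-filter⁺ (λ u → ¬? (u ∈? verts e)) (∈-allFin u) u∉e

collapse : ∀ {n} (e : Hyperedge n) → Fin n → Fin (suc (length (outside e)))
collapse e u with u ∈? verts e
... | yes _  = zero
... | no u∉e = suc (index (∈-outside e u∉e))

contractEdge : ∀ {n} (e : Hyperedge n) →
               Hyperedge n → Hyperedge (suc (length (outside e)))
contractEdge e f = hyperedge
  (map (collapse e) (verts f))
  (subst (1 <_) (sym (length-map (collapse e) (verts f))) (1<d f))

_/_ : (H : Hypergraph) → E H → Hypergraph
H / e = hypergraph
  (suc (length (outside ê)))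
  (map (contractEdge ê) (removeAt (edges H) e))
  where ê = lookup (edges H) e

------------------------------------------------------------------------
-- The bipartite incidence graph

Node : Hypergraph → Set
Node H = Fin (∣V∣ H) ⊎ E H

-- `Joined H a b` is the set of edges between a and b.
data Joined (H : Hypergraph) : Node H → Node H → Set where
  joined : ∀ {u e} → u ∈ verts (lookup (edges H) e) → Joined H (inj₁ u) (inj₂ e)

Connected : (H : Hypergraph) → Rel (Node H) _
Connected H = EqClosure (Joined H)

nodes : (H : Hypergraph) → List (Node H)
nodes H = map inj₁ (allFin _) ++ map inj₂ (allFin _)

∈-nodes : (H : Hypergraph) (a : Node H) → a ∈ nodes H
∈-nodes H (inj₁ u) = ∈-++⁺ˡ (∈-map⁺ inj₁ (∈-allFin u))
∈-nodes H (inj₂ e) = ∈-++⁺ʳ (map inj₁ (allFin _)) (∈-map⁺ inj₂ (∈-allFin e))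

_≟ₙ_ : ∀ {H} → DecidableEquality (Node H)
_≟ₙ_ = Sum.≡-dec _≟_ _≟_

joined? : (H : Hypergraph) → Decidable (Joined H)
joined? H (inj₁ u) (inj₁ _) = no λ ()
joined? H (inj₁ u) (inj₂ e) =
  map′ joined (λ { (joined u∈e) → u∈e }) (u ∈? verts (lookup (edges H) e))
joined? H (inj₂ _) _        = no λ ()

-- Connectedness by a finite list of edges is decidable: a path either
-- avoids the head (a , b) of the list, or may be taken to use it once.

module _ {A : Set} (_≟ᴬ_ : DecidableEquality A) where

  Linked : List (A × A) → Rel A _
  Linked L = EqClosure (λ a b → (a , b) ∈ L)

  linked? : ∀ L → Decidable (Linked L)
  linked? [] s t = map′ (λ { refl → ε }) discrete (s ≟ᴬ t)
    where
    discrete : ∀ {s t} → Linked [] s t → s ≡ t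
    discrete ε            = refl
    discrete (fwd () ◅ _)
    discrete (bwd () ◅ _)
  linked? ((a , b) ∷ L) s t = map′ to from
    (linked? L s t
      ⊎-dec (linked? L s a ×-dec linked? L b t)
      ⊎-dec (linked? L s b ×-dec linked? L a t))
    where
    Split : Rel A _
    Split s t = Linked L s t
              ⊎ (Linked L s a × Linked L b t)
              ⊎ (Linked L s b × Linked L a t)

    weaken : ∀ {s t} → Linked L s t → Linked ((a , b) ∷ L) s t
    weaken = EqC.map there

    to : Split s t → Linked ((a , b) ∷ L) s t
    to (inj₁ p)              = weaken p
    to (inj₂ (inj₁ (p , q))) = weaken p ◅◅ fwd (here refl) ◅ weaken q
    to (inj₂ (inj₂ (p , q))) = weaken p ◅◅ bwd (here refl) ◅ weaken q

    prepend : ∀ {s r t} → SymClosure (λ a b → (a , b) ∈ L) s r → Split r t → Split s t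
    prepend x (inj₁ p)              = inj₁ (x ◅ p)
    prepend x (inj₂ (inj₁ (p , q))) = inj₂ (inj₁ (x ◅ p , q))
    prepend x (inj₂ (inj₂ (p , q))) = inj₂ (inj₂ (x ◅ p , q))

    from : ∀ {s t} → Linked ((a , b) ∷ L) s t → Split s t
    from ε                     = inj₁ ε
    from (fwd (there x) ◅ p)   = prepend (fwd x) (from p)
    from (bwd (there x) ◅ p)   = prepend (bwd x) (from p)
    from (fwd (here refl) ◅ p) with from p
    ... | inj₁ q              = inj₂ (inj₁ (ε , q))
    ... | inj₂ (inj₁ (_ , q)) = inj₂ (inj₁ (ε , q))
    ... | inj₂ (inj₂ (_ , q)) = inj₁ q
    from (bwd (here refl) ◅ p) with from p
    ... | inj₁ q              = inj₂ (inj₂ (ε , q))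
    ... | inj₂ (inj₁ (_ , q)) = inj₁ q
    ... | inj₂ (inj₂ (_ , q)) = inj₂ (inj₂ (ε , q))

connected? : (H : Hypergraph) → Decidable (Connected H)
connected? H a b = map′
  (EqC.map (λ p → proj₂ (∈-filter⁻ joined×? {xs = pairs} p)))
  (EqC.map (λ {a} {b} j →
    ∈-filter⁺ joined×? (∈-cartesianProduct⁺ (∈-nodes H a) (∈-nodes H b)) j))
  (linked? (_≟ₙ_ {H}) (filter joined×? pairs) a b)
  where
  pairs    = cartesianProduct (nodes H) (nodes H)
  joined×? = λ (p : Node H × Node H) → joined? H (proj₁ p) (proj₂ p)

-- The number of connected components: `deduplicate` keeps exactly one
-- node from each.
κ : Hypergraph → ℕ
κ H = length (deduplicate (connected? H) (nodes H))

------------------------------------------------------------------------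
-- The Tutte polynomial

-- All differences written with _∸_ below are between numbers of which
-- the first is at least the second, so there is no truncation: the
-- number of components drops by at most d(e) ∸ 1 when a hyperedge e is
-- added, and does not increase; and v(e) ≤ d(e).

-- The polynomial is evaluated at arbitrary elements x, y of an arbitrary
-- commutative ring; taking x and y to be the indeterminates of ℤ[x,y]
-- gives the polynomial itself.

module _ {c ℓ} (R : CommutativeRing c ℓ) where
  open CommutativeRing R
    using (Carrier; _-_; _*_; 0#; 1#; semiring)
    renaming (_+_ to _⊕_)
  open Exp semiring using (_^_)

  T-HG : Hypergraph → Carrier → Carrier → Carrier
  T-HG H x y = foldr _⊕_ 0# (map term (subsets (edges H)))
    where
    term : List (Hyperedge (∣V∣ H)) → Carrier
    term A = (x - 1#) ^ (κ (H ∣ₑ A) ∸ κ H)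
           * (y - 1#) ^ ((dₑ A + κ (H ∣ₑ A)) ∸ (length A + ∣V∣ H))

Δ : (H : Hypergraph) → E H → ℕ
Δ H e = κ (H ∖ e) ∸ κ H

m : (H : Hypergraph) → E H → ℕ
m H e = d (lookup (edges H) e) ∸ v (lookup (edges H) e)

{-# OPTIONS --safe #-}

-- A subset A of E either avoids e, or is e together with some B ⊆ E ∖ {e}.
-- In the first case the summands of T(H) and T(H ∖ e) at A differ by the
-- factor (x - 1)^Δ(e).  In the second the components of (V , {e} ∪ B) are
-- those of B in H / e, and |V(H / e)| = 1 + |V| - v(e), so the summand at
-- {e} ∪ B is (y - 1)^m(e) times the summand of T(H / e) at B.  That the
-- exponents really are nonnegative, |V| + |A| ≤ d(A) + κ(A), follows by
-- contracting the hyperedges of A one after another.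

module Submission where

open import Defs
open import Algebra.Bundles using (CommutativeRing; Semiring)
import Algebra.Properties.CommutativeSemigroup as CommutativeSemigroupProperties
import Algebra.Properties.Semiring.Exp as Exp
open import Data.Fin.Base using (Fin; zero; suc)
open import Data.Fin.Properties using (injective⇒≤)
open import Data.List.Base
  using (List; []; _∷_; _++_; map; foldr; length; filter; deduplicate;
         lookup; removeAt; allFin)
open import Data.List.Membership.Propositional using (_∈_)
open import Data.List.Membership.Propositional.Properties
  using (∈-filter⁻; ∈-map⁺; ∈-map⁻; ∈-lookup)
open import Data.List.Properties using (length-map; length-tabulate; map-++; map-∘)
open import Data.List.Relation.Binary.Permutation.Propositional
  using (_↭_; prep; swap; ↭-sym; ↭-refl; ↭-trans)
import Data.List.Relation.Binary.Permutation.Propositional.Properties as ↭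
open import Data.List.Relation.Binary.Subset.Propositional using (_⊆_)
open import Data.List.Relation.Binary.Subset.Propositional.Properties
  using (∷⁺ʳ; ⊆-reflexive-↭)
open import Data.List.Relation.Unary.All as All using ([]; _∷_)
open import Data.List.Relation.Unary.AllPairs using (AllPairs; []; _∷_)
open import Data.List.Relation.Unary.Any as Any using (Any; here; there; index)
import Data.List.Relation.Unary.Any.Properties as AnyP
open import Data.List.Relation.Unary.Unique.Propositional using (Unique)
import Data.List.Relation.Unary.Unique.DecSetoid.Properties as UniqueDec
import Data.List.Relation.Unary.Unique.Propositional.Properties as Unique
open import Data.Nat.Base as ℕ using (ℕ; suc; _∸_; _≤_)
open import Data.Nat.ListAction.Properties using (sum-↭)
open import Data.Nat.Properties
  using (+-suc; +-assoc; +-∸-assoc; +-∸-comm; [m+n]∸[m+o]≡n∸o; m+[n∸m]≡n;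
         +-monoʳ-≤; ≤-antisym; module ≤-Reasoning)
open import Data.Nat.Tactic.RingSolver using (solve-∀)
open import Data.Product.Base using (_,_; proj₁; proj₂; ∃)
open import Data.Sum.Base using (inj₁; inj₂)
open import Function.Base using (_∘_; id)
open import Level using (Level)
open import Relation.Binary.Bundles using (DecSetoid)
open import Relation.Binary.Construct.Closure.Equivalence as EqC using (EqClosure)
open import Relation.Binary.Construct.Closure.ReflexiveTransitive using (ε; _◅_; _◅◅_)
open import Relation.Binary.Construct.Closure.Symmetric using (fwd; bwd)
open import Relation.Binary.Core using (Rel; REL; _Preserves_⟶_)
open import Relation.Binary.PropositionalEquality
  using (_≡_; refl; sym; trans; cong; cong₂; subst; module ≡-Reasoning)
open import Relation.Nullary.Decidable using (yes; no; ¬?)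
open import Relation.Nullary.Negation using (¬_; contradiction)
open import Relation.Unary using (Pred; Decidable)

private
  variable
    a b p q : Level
    A : Set a
    B : Set b
    n : ℕ

-- Lists

-- `AllPairs` relates earlier entries to later ones only, and `Q` may fail to be symmetric, so both
-- directions are refuted: one excludes `i` before `j`, the other `j` before `i`.
AllPairs-lookup : {Q : Rel A q} {xs : List A} → AllPairs Q xs → ∀ i j →
                  ¬ Q (lookup xs i) (lookup xs j) → ¬ Q (lookup xs j) (lookup xs i) → i ≡ j
AllPairs-lookup (_ ∷ _)  zero    zero    _ _ = refl
AllPairs-lookup (q ∷ _)  zero    (suc j) ¬Q _ = contradiction (All.lookup q (∈-lookup j)) ¬Q
AllPairs-lookup (q ∷ _)  (suc i) zero    _ ¬Q = contradiction (All.lookup q (∈-lookup i)) ¬Q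
AllPairs-lookup (_ ∷ qs) (suc i) (suc j) ¬Q ¬Q′ = cong suc (AllPairs-lookup qs i j ¬Q ¬Q′)

-- Pigeonhole: every entry of `xs` picks a `P`-related position of `ys`, and two positions of `xs`
-- with the same choice would violate `Q`.
AllPairs-length-≤ : {Q : Rel A q} (P : REL A B p) {xs : List A} {ys : List B} →
                    (∀ {x x′ y} → P x y → P x′ y → ¬ Q x x′) →
                    AllPairs Q xs → (∀ {x} → x ∈ xs → Any (P x) ys) →
                    length xs ≤ length ys
AllPairs-length-≤ P {xs} {ys} disjoint qs f = injective⇒≤ {f = g} g-injective
  where
  g : Fin (length xs) → Fin (length ys)
  g i = index (f (∈-lookup i))

  related : ∀ i → P (lookup xs i) (lookup ys (g i))
  related i = AnyP.lookup-index (f (∈-lookup i))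

  g-injective : ∀ {i j} → g i ≡ g j → i ≡ j
  g-injective {i} {j} eq = AllPairs-lookup qs i j (disjoint Pᵢ (related j)) (disjoint (related j) Pᵢ)
    where Pᵢ = subst (P (lookup xs i) ∘ lookup ys) eq (related i)

length-filter-¬ : {P : Pred A p} (P? : Decidable P) (xs : List A) →
                  length (filter (λ x → ¬? (P? x)) xs) ℕ.+ length (filter P? xs) ≡ length xs
length-filter-¬ P? []       = refl
length-filter-¬ P? (x ∷ xs) with P? x
... | yes _ = trans (+-suc _ _) (cong suc (length-filter-¬ P? xs))
... | no  _ = cong suc (length-filter-¬ P? xs)

removeAt-↭ : (xs : List A) (i : Fin (length xs)) → xs ↭ lookup xs i ∷ removeAt xs i
removeAt-↭ (x ∷ xs) zero    = ↭-refl
removeAt-↭ (x ∷ xs) (suc i) = ↭-trans (prep x (removeAt-↭ xs i)) (swap x _ ↭-refl)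

length-allFin : ∀ n → length (allFin n) ≡ n
length-allFin n = length-tabulate id

-- Connectedness of vertices

-- Two steps of the incidence graph, through one hyperedge. Giving it by membership instead of by
-- position makes adjacency depend only on which hyperedges occur in `A`.
data Adjacent (A : List (Hyperedge n)) (u w : Fin n) : Set where
  adjacent : ∀ {f} → f ∈ A → u ∈ verts f → w ∈ verts f → Adjacent A u w

VLinked : List (Hyperedge n) → Rel (Fin n) _
VLinked A = EqClosure (Adjacent A)

VLinked-mono : {A A′ : List (Hyperedge n)} → A ⊆ A′ → ∀ {u w} → VLinked A u w → VLinked A′ u w
VLinked-mono A⊆A′ = EqC.map λ { (adjacent f∈A u∈f w∈f) → adjacent (A⊆A′ f∈A) u∈f w∈f }

VLinked-[] : ∀ {u w : Fin n} → VLinked [] u w → u ≡ w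
VLinked-[] ε                             = refl
VLinked-[] (fwd (adjacent () _ _) ◅ _)
VLinked-[] (bwd (adjacent () _ _) ◅ _)

some-vertex : (e : Hyperedge n) → ∃ (_∈ verts e)
some-vertex (hyperedge (u ∷ _) _) = u , here refl

module _ (H : Hypergraph) where

  -- Hyperedges are nonempty, so every hyperedge node shares its component with a vertex, and
  -- components can be compared through vertices alone.
  toVertex : Node H → Fin (∣V∣ H)
  toVertex (inj₁ u) = u
  toVertex (inj₂ e) = proj₁ (some-vertex (lookup (edges H) e))

  connected-toVertex : ∀ a → Connected H a (inj₁ (toVertex a))
  connected-toVertex (inj₁ u) = ε
  connected-toVertex (inj₂ e) = bwd (joined (proj₂ (some-vertex (lookup (edges H) e)))) ◅ ε

  Connected⇒VLinked : ∀ {a b} → Connected H a b → VLinked (edges H) (toVertex a) (toVertex b)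
  Connected⇒VLinked = EqC.gmap toVertex
    λ { (joined {e = e} u∈e) →
          adjacent (∈-lookup e) u∈e (proj₂ (some-vertex (lookup (edges H) e))) }

  VLinked⇒Connected : ∀ {u w} → VLinked (edges H) u w → Connected H (inj₁ u) (inj₁ w)
  VLinked⇒Connected = EqC.gfold (EqC.isEquivalence (Joined H)) inj₁
    λ { (adjacent f∈E u∈f w∈f) →
          fwd (joined (subst (λ g → _ ∈ verts g) (AnyP.lookup-index f∈E) u∈f)) ◅
          bwd (joined (subst (λ g → _ ∈ verts g) (AnyP.lookup-index f∈E) w∈f)) ◅ ε }

  -- Numbers of connected components

  Connected-decSetoid : DecSetoid _ _
  Connected-decSetoid = record
    { Carrier          = Node H
    ; _≈_              = Connected H
    ; isDecEquivalence = record
      { isEquivalence = EqC.isEquivalence (Joined H)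
      ; _≟_           = connected? H
      }
    }

  components : List (Node H)
  components = deduplicate (connected? H) (nodes H)

  components-separated : AllPairs (λ a b → ¬ Connected H a b) components
  components-separated = UniqueDec.deduplicate-! Connected-decSetoid (nodes H)

  components-complete : ∀ a → Any (Connected H a) components
  components-complete a = AnyP.deduplicate⁺ (connected? H)
    (λ c~b a~b → a~b ◅◅ EqC.symmetric _ c~b) (Any.map (λ { refl → ε }) (∈-nodes H a))

  -- Distinct vertices then lie in distinct components. This is the edgeless base case of
  -- `rank-bound`.
  order-≤-κ : (∀ {u w} → VLinked (edges H) u w → u ≡ w) → ∣V∣ H ≤ κ H
  order-≤-κ discrete = subst (_≤ κ H) (length-allFin (∣V∣ H))
    (AllPairs-length-≤ (λ u b → Connected H (inj₁ u) b)
      (λ u~b w~b u≢w → u≢w (discrete (Connected⇒VLinked (u~b ◅◅ EqC.symmetric _ w~b))))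
      (Unique.allFin⁺ (∣V∣ H)) (λ {u} _ → components-complete (inj₁ u)))

-- A vertex map that reflects linkage is injective on components. It is applied with `id`,
-- `collapse e` and `representative e` as `φ`.
κ-≤ : ∀ H H′ (φ : Fin (∣V∣ H) → Fin (∣V∣ H′)) →
      (∀ {u w} → VLinked (edges H′) (φ u) (φ w) → VLinked (edges H) u w) → κ H ≤ κ H′
κ-≤ H H′ φ reflects = AllPairs-length-≤ (λ a b → Connected H′ (image a) b)
  (λ a~b a′~b a≁a′ → a≁a′ (image-reflects (a~b ◅◅ EqC.symmetric _ a′~b)))
  (components-separated H) (λ {a} _ → components-complete H′ (image a))
  where
  image : Node H → Node H′
  image a = inj₁ (φ (toVertex H a))

  image-reflects : ∀ {a a′} → Connected H′ (image a) (image a′) → Connected H a a′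
  image-reflects {a} {a′} c =
    connected-toVertex H a ◅◅
    VLinked⇒Connected H (reflects (Connected⇒VLinked H′ c)) ◅◅
    EqC.symmetric _ (connected-toVertex H a′)

κ-antitone : {A A′ : List (Hyperedge n)} → A ⊆ A′ → κ (hypergraph n A′) ≤ κ (hypergraph n A)
κ-antitone {A = A} {A′} A⊆A′ = κ-≤ (hypergraph _ A′) (hypergraph _ A) id (VLinked-mono A⊆A′)

κ-↭ : {A A′ : List (Hyperedge n)} → A ↭ A′ → κ (hypergraph n A) ≡ κ (hypergraph n A′)
κ-↭ A↭A′ = ≤-antisym (κ-antitone (⊆-reflexive-↭ (↭-sym A↭A′))) (κ-antitone (⊆-reflexive-↭ A↭A′))

-- Contraction

module _ (e : Hyperedge n) where

  outside-unique : Unique (outside e)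
  outside-unique = Unique.filter⁺ (λ u → ¬? (u ∈? verts e)) (Unique.allFin⁺ n)

  -- A section of `collapse e`, used to carry links of the contraction back.
  representative : Fin (suc (length (outside e))) → Fin n
  representative zero    = proj₁ (some-vertex e)
  representative (suc i) = lookup (outside e) i

  collapse-representative : ∀ i → collapse e (representative i) ≡ i
  collapse-representative zero with representative zero ∈? verts e
  ... | yes _  = refl
  ... | no u∉e = contradiction (proj₂ (some-vertex e)) u∉e
  collapse-representative (suc i) with representative (suc i) ∈? verts e
  ... | yes u∈e = contradiction u∈e
          (proj₂ (∈-filter⁻ (λ u → ¬? (u ∈? verts e)) {xs = allFin n} (∈-lookup i)))
  -- `outside e` has no repetitions, so the position found by membership is `i` itself.
  ... | no u∉e  = cong suc (AllPairs-lookup outside-unique _ i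
          (λ u≢w → u≢w (sym u≡w)) (λ u≢w → u≢w u≡w))
    where u≡w = AnyP.lookup-index (∈-outside e u∉e)

  collapse-∈ : ∀ {u} → u ∈ verts e → collapse e u ≡ zero
  collapse-∈ {u} u∈e with u ∈? verts e
  ... | yes _  = refl
  ... | no u∉e = contradiction u∈e u∉e

  order-outside : length (outside e) ℕ.+ v e ≡ n
  order-outside = trans (length-filter-¬ (_∈? verts e) (allFin n)) (length-allFin n)

  v≤d : v e ≤ d e
  v≤d = AllPairs-length-≤ _≡_ (λ { refl refl u≢u → u≢u refl })
    (Unique.filter⁺ (_∈? verts e) (Unique.allFin⁺ n))
    (λ u∈ → proj₂ (∈-filter⁻ (_∈? verts e) {xs = allFin n} u∈))

  module _ (B : List (Hyperedge n)) where

    private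
      B′ = map (contractEdge e) B

    -- A vertex of `e` is linked to its representative through `e` itself; any other vertex is its
    -- own representative.
    linked-representative : ∀ u → VLinked (e ∷ B) u (representative (collapse e u))
    linked-representative u with u ∈? verts e
    ... | yes u∈e = fwd (adjacent (here refl) u∈e (proj₂ (some-vertex e))) ◅ ε
    ... | no u∉e  = subst (VLinked (e ∷ B) u) (AnyP.lookup-index (∈-outside e u∉e)) ε

    collapse-linked : ∀ {u w} → VLinked (e ∷ B) u w → VLinked B′ (collapse e u) (collapse e w)
    collapse-linked = EqC.gfold (EqC.isEquivalence _) (collapse e) step
      where
      step : ∀ {u w} → Adjacent (e ∷ B) u w → VLinked B′ (collapse e u) (collapse e w)
      step (adjacent (here refl) u∈e w∈e) rewrite collapse-∈ u∈e | collapse-∈ w∈e = ε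
      step (adjacent (there f∈B) u∈f w∈f) =
        fwd (adjacent (∈-map⁺ (contractEdge e) f∈B)
          (∈-map⁺ (collapse e) u∈f) (∈-map⁺ (collapse e) w∈f)) ◅ ε

    -- A contracted hyperedge comes from some `f` in `B`, whose vertices `u` and `w` need only
    -- collapse to `i` and `j`; `linked-representative` bridges the difference at both ends.
    representative-linked : ∀ {i j} → VLinked B′ i j →
                            VLinked (e ∷ B) (representative i) (representative j)
    representative-linked = EqC.gfold (EqC.isEquivalence _) representative step
      where
      step : ∀ {i j} → Adjacent B′ i j → VLinked (e ∷ B) (representative i) (representative j)
      step (adjacent f′∈B′ i∈f′ j∈f′) with ∈-map⁻ (contractEdge e) f′∈B′
      ... | f , f∈B , refl with ∈-map⁻ (collapse e) i∈f′ | ∈-map⁻ (collapse e) j∈f′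
      ...   | u , u∈f , refl | w , w∈f , refl =
        EqC.symmetric _ (linked-representative u) ◅◅
        fwd (adjacent (there f∈B) u∈f w∈f) ◅ linked-representative w

    -- The vertices of `e` are already in one component, so merging them changes nothing. Each of
    -- `collapse e` and `representative` reflects links because the other preserves them.
    κ-contract : κ (hypergraph n (e ∷ B)) ≡ κ (hypergraph _ B′)
    κ-contract = ≤-antisym
      (κ-≤ (hypergraph _ (e ∷ B)) (hypergraph _ B′) (collapse e) λ {u} {w} c →
        linked-representative u ◅◅ representative-linked c ◅◅
        EqC.symmetric _ (linked-representative w))
      (κ-≤ (hypergraph _ B′) (hypergraph _ (e ∷ B)) representative λ {i} {j} c →
        subst (λ k → VLinked B′ k j) (collapse-representative i)
          (subst (VLinked B′ _) (collapse-representative j) (collapse-linked c)))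

  dₑ-contract : ∀ B → dₑ (map (contractEdge e) B) ≡ dₑ B
  dₑ-contract []      = refl
  dₑ-contract (f ∷ B) = cong₂ ℕ._+_ (length-map (collapse e) (verts f)) (dₑ-contract B)

-- Contracting `e` keeps the number of components and removes `v e - 1`, hence at most `d e - 1`,
-- vertices; without hyperedges every vertex is a component.
rank-bound : (A : List (Hyperedge n)) → length A ℕ.+ n ≤ dₑ A ℕ.+ κ (hypergraph n A)
rank-bound A = go (length A) A refl
  where
  -- The recursive call concerns a mapped list over another vertex set, so the induction is on the
  -- number `k` of hyperedges, with `n` varying.
  go : ∀ k {n} (A : List (Hyperedge n)) → length A ≡ k → length A ℕ.+ n ≤ dₑ A ℕ.+ κ (hypergraph n A)
  go 0       []      _    = order-≤-κ (hypergraph _ []) VLinked-[]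
  go (suc k) {n} (e ∷ B) refl = begin
    suc (length B) ℕ.+ n
      ≡⟨ cong (suc (length B) ℕ.+_) (order-outside e) ⟨
    suc (length B) ℕ.+ (length (outside e) ℕ.+ v e)
      ≤⟨ +-monoʳ-≤ (suc (length B)) (+-monoʳ-≤ (length (outside e)) (v≤d e)) ⟩
    suc (length B) ℕ.+ (length (outside e) ℕ.+ d e)
      -- The 1 that counted `e` now counts the new vertex of the contraction.
      ≡⟨ rearrange (length B) (length (outside e)) (d e) ⟩
    d e ℕ.+ (length B ℕ.+ suc (length (outside e)))
      ≡⟨ cong (λ l → d e ℕ.+ (l ℕ.+ suc (length (outside e)))) (length-map (contractEdge e) B) ⟨
    d e ℕ.+ (length B′ ℕ.+ suc (length (outside e)))
      ≤⟨ +-monoʳ-≤ (d e) (go k B′ (length-map _ B)) ⟩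
    d e ℕ.+ (dₑ B′ ℕ.+ κ (hypergraph _ B′))
      ≡⟨ cong₂ (λ s t → d e ℕ.+ (s ℕ.+ t)) (dₑ-contract e B) (sym (κ-contract e B)) ⟩
    d e ℕ.+ (dₑ B ℕ.+ κ (hypergraph n (e ∷ B)))
      ≡⟨ +-assoc (d e) (dₑ B) _ ⟨
    dₑ (e ∷ B) ℕ.+ κ (hypergraph n (e ∷ B)) ∎
    where
    open ≤-Reasoning
    B′ = map (contractEdge e) B

    rearrange : ∀ b o d → suc b ℕ.+ (o ℕ.+ d) ≡ d ℕ.+ (b ℕ.+ suc o)
    rearrange = solve-∀

-- The exponent of `y - 1`, with the positive terms collected first; by `rank-bound` the subtraction
-- is exact.
nullity : List (Hyperedge n) → ℕ
nullity {n} A = (dₑ A ℕ.+ κ (hypergraph n A)) ∸ (length A ℕ.+ n)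

nullity-↭ : {A A′ : List (Hyperedge n)} → A ↭ A′ → nullity A ≡ nullity A′
nullity-↭ {n} A↭A′ = cong₂ _∸_
  (cong₂ ℕ._+_ (sum-↭ (↭.map⁺ d A↭A′)) (κ-↭ A↭A′)) (cong (ℕ._+ n) (↭.↭-length A↭A′))

nullity-contract : (e : Hyperedge n) (B : List (Hyperedge n)) →
                   nullity (e ∷ B) ≡ (d e ∸ v e) ℕ.+ nullity (map (contractEdge e) B)
nullity-contract {n} e B = begin
  (d e ℕ.+ dₑ B ℕ.+ κ (hypergraph n (e ∷ B))) ∸ (suc (length B) ℕ.+ n)
    ≡⟨ cong₂ _∸_
         (trans (+-assoc (d e) _ _)
           (cong₂ ℕ._+_ (sym (m+[n∸m]≡n (v≤d e)))
             (cong₂ ℕ._+_ (sym (dₑ-contract e B)) (κ-contract e B))))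
         (cong₂ (λ l k → suc l ℕ.+ k) (sym (length-map (contractEdge e) B)) (sym (order-outside e))) ⟩
  (v e ℕ.+ (d e ∸ v e) ℕ.+ X) ∸ (suc (length B′) ℕ.+ (o ℕ.+ v e))
    ≡⟨ cong₂ _∸_ (+-assoc (v e) (d e ∸ v e) X) (rearrange (length B′) o (v e)) ⟩
  (v e ℕ.+ ((d e ∸ v e) ℕ.+ X)) ∸ (v e ℕ.+ (length B′ ℕ.+ suc o))
    ≡⟨ [m+n]∸[m+o]≡n∸o (v e) _ _ ⟩
  ((d e ∸ v e) ℕ.+ X) ∸ (length B′ ℕ.+ suc o)
    -- The summand may leave the truncated difference only because `rank-bound` holds for the
    -- contracted list.
    ≡⟨ +-∸-assoc (d e ∸ v e) (rank-bound B′) ⟩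
  (d e ∸ v e) ℕ.+ nullity B′ ∎
  where
  open ≡-Reasoning
  B′ = map (contractEdge e) B
  o  = length (outside e)
  X  = dₑ B′ ℕ.+ κ (hypergraph _ B′)

  rearrange : ∀ b o v → suc b ℕ.+ (o ℕ.+ v) ≡ v ℕ.+ (b ℕ.+ suc o)
  rearrange = solve-∀

-- Sums over subsets

module SubsetSums {c ℓ} (S : Semiring c ℓ) where
  open Semiring S
    using (Carrier; _≈_; _*_; 0#; setoid; +-cong; +-congˡ; +-congʳ; +-identityˡ; +-identityʳ;
           distribˡ; +-commutativeSemigroup)
    renaming (_+_ to _⊕_; refl to ≈-refl; sym to ≈-sym; trans to ≈-trans; +-assoc to ⊕-assoc)
  open CommutativeSemigroupProperties +-commutativeSemigroup using (interchange)
  open import Relation.Binary.Reasoning.Setoid setoid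

  ∑ : List Carrier → Carrier
  ∑ = foldr _⊕_ 0#

  ∑-++ : ∀ xs ys → ∑ (xs ++ ys) ≈ ∑ xs ⊕ ∑ ys
  ∑-++ []       ys = ≈-sym (+-identityˡ _)
  ∑-++ (x ∷ xs) ys = ≈-trans (+-congˡ (∑-++ xs ys)) (≈-sym (⊕-assoc x _ _))

  -- Follows the recursion of `subsets`, but stores the chosen elements in the summand, so that
  -- inductions meet neither `map` nor `++`.
  ∑⊆ : (List A → Carrier) → List A → Carrier
  ∑⊆ g []       = g []
  ∑⊆ g (x ∷ xs) = ∑⊆ (g ∘ (x ∷_)) xs ⊕ ∑⊆ g xs

  ∑-subsets : (g : List A → Carrier) (xs : List A) → ∑ (map g (subsets xs)) ≈ ∑⊆ g xs
  ∑-subsets g []       = +-identityʳ _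
  ∑-subsets g (x ∷ xs) = begin
    ∑ (map g (map (x ∷_) (subsets xs) ++ subsets xs))
      ≡⟨ cong ∑ (map-++ g (map (x ∷_) (subsets xs)) (subsets xs)) ⟩
    ∑ (map g (map (x ∷_) (subsets xs)) ++ map g (subsets xs))
      ≈⟨ ∑-++ (map g (map (x ∷_) (subsets xs))) _ ⟩
    ∑ (map g (map (x ∷_) (subsets xs))) ⊕ ∑ (map g (subsets xs))
      ≡⟨ cong (λ l → ∑ l ⊕ ∑ (map g (subsets xs))) (map-∘ (subsets xs)) ⟨
    ∑ (map (g ∘ (x ∷_)) (subsets xs)) ⊕ ∑ (map g (subsets xs))
      ≈⟨ +-cong (∑-subsets (g ∘ (x ∷_)) xs) (∑-subsets g xs) ⟩
    ∑⊆ g (x ∷ xs) ∎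

  -- The inclusion `ys ⊆ xs` is made available for `term-deletion`, where it bounds a number of
  -- components.
  ∑⊆-cong : {g h : List A → Carrier} (xs : List A) →
            (∀ ys → ys ⊆ xs → g ys ≈ h ys) → ∑⊆ g xs ≈ ∑⊆ h xs
  ∑⊆-cong []       g≈h = g≈h [] id
  ∑⊆-cong (x ∷ xs) g≈h = +-cong
    (∑⊆-cong xs (λ ys ys⊆xs → g≈h (x ∷ ys) (∷⁺ʳ x ys⊆xs)))
    (∑⊆-cong xs (λ ys ys⊆xs → g≈h ys (there ∘ ys⊆xs)))

  ∑⊆-map : (g : List B → Carrier) (f : A → B) (xs : List A) →
           ∑⊆ g (map f xs) ≈ ∑⊆ (g ∘ map f) xs
  ∑⊆-map g f []       = ≈-refl
  ∑⊆-map g f (x ∷ xs) = +-cong (∑⊆-map (g ∘ (f x ∷_)) f xs) (∑⊆-map g f xs)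

  *-distribˡ-∑⊆ : ∀ k (g : List A → Carrier) xs → k * ∑⊆ g xs ≈ ∑⊆ (λ ys → k * g ys) xs
  *-distribˡ-∑⊆ k g []       = ≈-refl
  *-distribˡ-∑⊆ k g (x ∷ xs) = ≈-trans (distribˡ k _ _)
    (+-cong (*-distribˡ-∑⊆ k (g ∘ (x ∷_)) xs) (*-distribˡ-∑⊆ k g xs))

  -- A subset contains the `i`-th element or not. Invariance under permutation lets that element
  -- move in front of chosen elements that precede it.
  ∑⊆-removeAt : (g : List A → Carrier) → g Preserves _↭_ ⟶ _≈_ → ∀ xs i →
                ∑⊆ g xs ≈ ∑⊆ (g ∘ (lookup xs i ∷_)) (removeAt xs i) ⊕ ∑⊆ g (removeAt xs i)
  ∑⊆-removeAt g g-↭ (x ∷ xs) zero    = ≈-refl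
  ∑⊆-removeAt g g-↭ (x ∷ xs) (suc i) = begin
    ∑⊆ (g ∘ (x ∷_)) xs ⊕ ∑⊆ g xs
      ≈⟨ +-cong (∑⊆-removeAt (g ∘ (x ∷_)) (g-↭ ∘ prep x) xs i) (∑⊆-removeAt g g-↭ xs i) ⟩
    (∑⊆ (λ ys → g (x ∷ z ∷ ys)) zs ⊕ ∑⊆ (g ∘ (x ∷_)) zs) ⊕ (∑⊆ (g ∘ (z ∷_)) zs ⊕ ∑⊆ g zs)
      -- Regroups the four sums by whether `z`, rather than `x`, is chosen.
      ≈⟨ interchange _ _ _ _ ⟩
    (∑⊆ (λ ys → g (x ∷ z ∷ ys)) zs ⊕ ∑⊆ (g ∘ (z ∷_)) zs) ⊕ (∑⊆ (g ∘ (x ∷_)) zs ⊕ ∑⊆ g zs)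
      ≈⟨ +-congʳ (+-congʳ (∑⊆-cong zs (λ _ _ → g-↭ (swap x z ↭-refl)))) ⟩
    (∑⊆ (λ ys → g (z ∷ x ∷ ys)) zs ⊕ ∑⊆ (g ∘ (z ∷_)) zs) ⊕ (∑⊆ (g ∘ (x ∷_)) zs ⊕ ∑⊆ g zs) ∎
    where
    z  = lookup xs i
    zs = removeAt xs i

-- Deletion and contraction in the summands of the polynomial

∸-telescope : ∀ {k l j} → k ≤ l → l ≤ j → j ∸ k ≡ (l ∸ k) ℕ.+ (j ∸ l)
∸-telescope {k} {l} {j} k≤l l≤j =
  trans (cong (_∸ k) (sym (m+[n∸m]≡n l≤j))) (+-∸-comm (j ∸ l) k≤l)

theorem2p4 :
    ∀ {c ℓ} (R : CommutativeRing c ℓ) →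
    let open CommutativeRing R
        open Exp semiring using (_^_)
    in
    (H : Hypergraph) (e : E H) (x y : Carrier) →
    T-HG R H x y ≈ (x - 1#) ^ Δ H e * T-HG R (H ∖ e) x y
                 + (y - 1#) ^ m H e * T-HG R (H / e) x y
theorem2p4 R H e x y = begin
  T-HG R H x y
    ≈⟨ ∑-subsets (term H) (edges H) ⟩
  ∑⊆ (term H) (edges H)
    ≈⟨ ∑⊆-removeAt (term H) term-↭ (edges H) e ⟩
  ∑⊆ (term H ∘ (ê ∷_)) rest ⊕ ∑⊆ (term H) rest
    ≈⟨ ⊕-comm _ _ ⟩
  ∑⊆ (term H) rest ⊕ ∑⊆ (term H ∘ (ê ∷_)) rest
    ≈⟨ +-cong (∑⊆-cong rest term-deletion) (∑⊆-cong rest (λ B _ → term-contraction B)) ⟩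
  ∑⊆ (λ A → X ^ Δ H e * term (H ∖ e) A) rest ⊕
  ∑⊆ (λ B → Y ^ m H e * term (H / e) (map (contractEdge ê) B)) rest
    ≈⟨ +-cong (*-distribˡ-∑⊆ _ (term (H ∖ e)) rest) (*-distribˡ-∑⊆ _ _ rest) ⟨
  X ^ Δ H e * ∑⊆ (term (H ∖ e)) rest ⊕
  Y ^ m H e * ∑⊆ (term (H / e) ∘ map (contractEdge ê)) rest
    ≈⟨ +-cong (*-congˡ (∑-subsets (term (H ∖ e)) rest))
              (*-congˡ (≈-trans
                (∑-subsets (term (H / e)) (edges (H / e)))
                (∑⊆-map (term (H / e)) (contractEdge ê) rest))) ⟨
  X ^ Δ H e * T-HG R (H ∖ e) x y ⊕ Y ^ m H e * T-HG R (H / e) x y ∎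
  where
  open CommutativeRing R
    using (Carrier; _≈_; _-_; _*_; 1#; semiring; setoid; *-congˡ; *-congʳ; +-cong; *-assoc;
           *-commutativeSemigroup)
    renaming (_+_ to _⊕_; trans to ≈-trans; reflexive to ≈-reflexive; +-comm to ⊕-comm)
  open Exp semiring using (_^_; ^-homo-*)
  open CommutativeSemigroupProperties *-commutativeSemigroup using (x∙yz≈y∙xz)
  open SubsetSums semiring
  open import Relation.Binary.Reasoning.Setoid setoid

  ê    = lookup (edges H) e
  rest = removeAt (edges H) e
  X    = x - 1#
  Y    = y - 1#

  -- Unfolds to the local summand of `T-HG`, so `∑-subsets` applies to the polynomials of `H`,
  -- `H ∖ e` and `H / e` directly.
  term : (G : Hypergraph) → List (Hyperedge (∣V∣ G)) → Carrier
  term G A = X ^ (κ (G ∣ₑ A) ∸ κ G) * Y ^ nullity A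

  term-↭ : term H Preserves _↭_ ⟶ _≈_
  term-↭ A↭A′ = ≈-reflexive (cong₂ (λ k l → X ^ (k ∸ κ H) * Y ^ l) (κ-↭ A↭A′) (nullity-↭ A↭A′))

  κ-H : κ H ≡ κ (H ∣ₑ (ê ∷ rest))
  κ-H = κ-↭ (removeAt-↭ (edges H) e)

  κ-H≤ : κ H ≤ κ (H ∖ e)
  κ-H≤ = subst (_≤ κ (H ∖ e)) (sym κ-H) (κ-antitone {A = rest} {ê ∷ rest} there)

  term-deletion : ∀ A → A ⊆ rest → term H A ≈ X ^ Δ H e * term (H ∖ e) A
  term-deletion A A⊆ = begin
    X ^ (κ (H ∣ₑ A) ∸ κ H) * Y ^ nullity A
      -- As `κ H ≤ κ (H ∖ e) ≤ κ (H ∣ₑ A)`, the exponent splits at `κ (H ∖ e)`, and its first part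
      -- is `Δ H e`.
      ≡⟨ cong (λ k → X ^ k * Y ^ nullity A) (∸-telescope κ-H≤ (κ-antitone A⊆)) ⟩
    X ^ (Δ H e ℕ.+ (κ (H ∣ₑ A) ∸ κ (H ∖ e))) * Y ^ nullity A
      ≈⟨ *-congʳ (^-homo-* X (Δ H e) _) ⟩
    X ^ Δ H e * X ^ (κ (H ∣ₑ A) ∸ κ (H ∖ e)) * Y ^ nullity A
      ≈⟨ *-assoc _ _ _ ⟩
    X ^ Δ H e * term (H ∖ e) A ∎

  term-contraction : ∀ B → term H (ê ∷ B) ≈ Y ^ m H e * term (H / e) (map (contractEdge ê) B)
  term-contraction B = begin
    X ^ (κ (H ∣ₑ (ê ∷ B)) ∸ κ H) * Y ^ nullity (ê ∷ B)
      ≡⟨ cong₂ (λ k l → X ^ k * Y ^ l)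
           -- `H` itself is, up to order, `ê` together with `rest`, so contraction preserves both
           -- terms of the difference.
           (cong₂ _∸_ (κ-contract ê B) (trans κ-H (κ-contract ê rest)))
           (nullity-contract ê B) ⟩
    X ^ (κ (H / e ∣ₑ B′) ∸ κ (H / e)) * Y ^ (m H e ℕ.+ nullity B′)
      ≈⟨ *-congˡ (^-homo-* Y (m H e) _) ⟩
    X ^ (κ (H / e ∣ₑ B′) ∸ κ (H / e)) * (Y ^ m H e * Y ^ nullity B′)
      ≈⟨ x∙yz≈y∙xz _ _ _ ⟩
    Y ^ m H e * term (H / e) B′ ∎
    where B′ = map (contractEdge ê) B
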